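{- For each integer $d\geq 0$, there is a triangle-free graph $G$ with feedback vertex number equal to $1$ that is not $2$-colourable with defect $d$.
   Context: Graphs are finite, simple and undirected. The feedback vertex number of a graph $G$ is the minimum size of a set $A\subseteq V(G)$ such that $G-A$ is a forest. A $2$-colouring assigns one of at most two colours to each vertex (not necessarily properly). A monochromatic component is a connected component of the subgraph induced by all vertices of a single colour. A colouring has defect $d$ if every monochromatic component has maximum degree at most $d$; $G$ is $2$-colourable with defect $d$ if it has a $2$-colouring with defect $d$. -}

module Defs where

open import Data.Fin.Base using (Fin; zero; suc; inject₁; fromℕ)
import Data.Fin.Properties as Fin
open import Data.Fin.Subset using (Subset; _∈_; _⊆_; _∩_; _─_; ∣_∣; Nonempty)
open import Data.Fin.Subset.Properties using (_∈?_; x∈p∩q⁺)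
open import Data.Nat.Base using (ℕ; _+_; _≤_)
open import Data.Product.Base using (_×_; _,_; ∃-syntax)
open import Data.Vec.Base using (tabulate)
open import Function.Base using (_∘_)
open import Function.Definitions using (Injective)
open import Level using (0ℓ)
open import Relation.Binary.Construct.Closure.ReflexiveTransitive using (Star)
open import Relation.Binary.Core using (Rel)
open import Relation.Binary.Definitions using (Decidable; Symmetric; Irreflexive)
open import Relation.Binary.PropositionalEquality using (_≡_)
open import Relation.Nullary.Decidable using (does; _×-dec_)
open import Relation.Nullary.Negation using (¬_)
import Relation.Unary as U

-- Finite simple undirected graphs whose vertex set V is a subset of Fin n.
-- V need not be all of Fin n, so that induced subgraphs are again graphs
-- over the same n.

record Graph (n : ℕ) : Set₁ where
  infix 4 _~_ _~?_
  field
    V        : Subset n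
    _~_      : Rel (Fin n) 0ℓ
    _~?_     : Decidable _~_
    ~-sym    : Symmetric _~_
    ~-irrefl : Irreflexive _≡_ _~_
    ~⇒∈V     : ∀ {u v} → u ~ v → u ∈ V

open Graph public using (V)

private
  variable
    n k : ℕ

⟦_⟧ : {P : U.Pred (Fin n) 0ℓ} → U.Decidable P → Subset n
⟦ P? ⟧ = tabulate (does ∘ P?)

infixl 8 _[_] _-V_

_[_] : Graph n → Subset n → Graph n
G [ S ] = record
  { V        = V G ∩ S
  ; _~_      = λ u v → u ∈ S × v ∈ S × u ~ v
  ; _~?_     = λ u v → (u ∈? S) ×-dec (v ∈? S) ×-dec (u ~? v)
  ; ~-sym    = λ (u∈S , v∈S , u~v) → v∈S , u∈S , ~-sym u~v
  ; ~-irrefl = λ u≡v (_ , _ , u~v) → ~-irrefl u≡v u~v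
  ; ~⇒∈V     = λ (u∈S , _ , u~v) → x∈p∩q⁺ (~⇒∈V u~v , u∈S)
  }
  where open Graph G using (_~_; _~?_; ~-sym; ~-irrefl; ~⇒∈V)

_-V_ : Graph n → Subset n → Graph n
G -V A = G [ V G ─ A ]

TriangleFree : Graph n → Set
TriangleFree G = ∀ u v w → ¬ (u ~ v × v ~ w × w ~ u)
  where open Graph G using (_~_)

degree : Graph n → Fin n → ℕ
degree G v = ∣ ⟦ v ~?_ ⟧ ∣
  where open Graph G using (_~?_)

MaxDegree≤ : ℕ → Graph n → Set
MaxDegree≤ d G = ∀ v → v ∈ V G → degree G v ≤ d

-- A cycle v₀ v₁ … v₂₊ₘ of length 3 + m.
record Cycle (G : Graph n) : Set where
  open Graph G using (_~_)
  field
    m         : ℕ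
    vertex    : Fin (3 + m) → Fin n
    injective : Injective _≡_ _≡_ vertex
    step      : ∀ (i : Fin (2 + m)) → vertex (inject₁ i) ~ vertex (suc i)
    close     : vertex (fromℕ (2 + m)) ~ vertex zero

Forest : Graph n → Set
Forest G = ¬ Cycle G

IsFeedbackVertexSet : Graph n → Subset n → Set
IsFeedbackVertexSet G A = A ⊆ V G × Forest (G -V A)

HasFeedbackVertexNumber : Graph n → ℕ → Set
HasFeedbackVertexNumber G k =
  (∃[ A ] IsFeedbackVertexSet G A × ∣ A ∣ ≡ k) ×
  (∀ A → IsFeedbackVertexSet G A → k ≤ ∣ A ∣)

Connected : Graph n → Set
Connected G = Nonempty (V G) × (∀ u v → u ∈ V G → v ∈ V G → Star _~_ u v)
  where open Graph G using (_~_)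

-- C is the vertex set of a component: a maximal subset of V G inducing a
-- connected subgraph.
IsComponent : Graph n → Subset n → Set
IsComponent G C =
  C ⊆ V G × Connected (G [ C ]) ×
  (∀ C′ → C′ ⊆ V G → Connected (G [ C′ ]) → C ⊆ C′ → C′ ⊆ C)

-- Colours given to elements of Fin n outside V G play no role.
Colouring : ℕ → Graph n → Set
Colouring {n} k G = Fin n → Fin k

monochromatic : (G : Graph n) → Colouring k G → Fin k → Graph n
monochromatic G c i = G [ ⟦ (λ v → c v Fin.≟ i) ⟧ ]

HasDefect : (G : Graph n) → Colouring k G → ℕ → Set
HasDefect G c d = ∀ i C → IsComponent (monochromatic G c i) C →
                  MaxDegree≤ d (monochromatic G c i [ C ])

ColourableWithDefect : ℕ → ℕ → Graph n → Set
ColourableWithDefect k d G = ∃[ c ] HasDefect {k = k} G c d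

{-# OPTIONS --safe #-}

-- Let N = d + 1.  A gadget is a hub (centre 0) joined to N further centres,
-- every centre having N private leaves; G consists of N disjoint gadgets and an
-- apex joined to all leaves, so deleting the apex leaves a forest.  Suppose G has
-- a 2-colouring with defect d.  The apex cannot have a neighbour of its own
-- colour in each of the N gadgets, so in some gadget all leaves have the colour
-- opposite to the apex.  A centre of that colour would have N leaves of its own
-- colour, so all centres have the colour of the apex; but then the hub has N
-- neighbours of its own colour.

module Submission where

open import Defs
open import Data.Bool.Base using (true)
open import Data.Fin.Base using (Fin; zero; suc; inject₁; fromℕ; toℕ)
open import Data.Fin.Properties
  using (_≟_; any?; sequence; suc-injective; toℕ-inject₁; +↔⊎; *↔×)
open import Data.Fin.Relation.Unary.Top using (view; ‵fromℕ; ‵inj₁)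
open import Data.Fin.Subset using (Subset; _∈_; _∉_; _─_; _-_; ∣_∣; ⁅_⁆; inside; outside)
  renaming (⊤ to full)
open import Data.Fin.Subset.Properties
  using (nonempty?; ∈⊤; x∈⁅x⁆; ∣⁅x⁆∣≡1; x∈p∩q⁺; x∈p∩q⁻;
         x∈p∧x∉q⇒x∈p─q; x∈p∧x≢y⇒x∈p-y; x∈p⇒∣p-x∣<∣p∣)
open import Data.Nat.Base using (ℕ; zero; suc; _+_; _*_; _≤_; z≤n; s≤s)
open import Data.Nat.Properties using (≤-trans; ≤-reflexive; <⇒≱; n<1+n; m<n⇒m<1+n)
open import Data.Product.Base using (_×_; _,_; proj₁; proj₂; ∃-syntax; Σ-syntax)
open import Data.Product.Function.NonDependent.Propositional using (_×-↔_)
open import Data.Sum.Base using (_⊎_; inj₁; inj₂; swap)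
open import Data.Sum.Function.Propositional using (_⊎-↔_)
open import Data.Vec.Base using ([]; _∷_; there; lookup)
open import Data.Vec.Properties using (lookup⇒[]=; []=⇒lookup; lookup∘tabulate)
open import Effect.Monad using (RawMonad)
open import Function.Base using (_∘_; _on_)
open import Function.Bundles using (Inverse; _↔_)
open import Function.Definitions using (Injective)
open import Function.Properties.Inverse using (↔-refl; ↔-trans)
open import Induction.WellFounded using (WellFounded; Acc; acc)
open import Level using (0ℓ)
import Relation.Binary.Construct.On as On
open import Relation.Binary.Construct.Closure.ReflexiveTransitive
  using (Star; ε; _◅_; _◅◅_; reverse) renaming (map to map⋆)
open import Relation.Binary.Core using (Rel)
open import Relation.Binary.Definitions using (Decidable)
open import Relation.Binary.PropositionalEquality
  using (_≡_; _≢_; refl; sym; trans; cong; subst; subst₂)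
open import Relation.Nullary.Decidable
  using (Dec; yes; no; does; dec-true; map′; _⊎-dec_; ¬¬-excluded-middle; decidable-stable)
open import Relation.Nullary.Negation using (¬_; contradiction; ¬¬-Monad)
import Relation.Unary as U

private
  variable
    n k d : ℕ

-- Membership and cardinality of subsets of `Fin n`.

module _ {P : U.Pred (Fin n) 0ℓ} (P? : U.Decidable P) where

  ∈⟦⟧⁺ : ∀ {x} → P x → x ∈ ⟦ P? ⟧
  ∈⟦⟧⁺ {x} px = lookup⇒[]= x _ (trans (lookup∘tabulate _ x) (dec-true (P? x) px))

  ∈⟦⟧⁻ : ∀ {x} → x ∈ ⟦ P? ⟧ → P x
  ∈⟦⟧⁻ {x} x∈ = true⇒ (P? x) (trans (sym (lookup∘tabulate _ x)) ([]=⇒lookup x∈))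
    where
    true⇒ : ∀ {A : Set} (a? : Dec A) → does a? ≡ true → A
    true⇒ (yes a) _ = a

x∈p─q⇒x∉q : ∀ (p q : Subset n) {x} → x ∈ p ─ q → x ∉ q
x∈p─q⇒x∉q (_ ∷ p) (outside ∷ q) (there x∈) (there x∈q) = x∈p─q⇒x∉q p q x∈ x∈q
x∈p─q⇒x∉q (_ ∷ p) (inside  ∷ q) (there x∈) (there x∈q) = x∈p─q⇒x∉q p q x∈ x∈q

injective⇒≤∣p∣ : ∀ (p : Subset n) (f : Fin k → Fin n) → Injective _≡_ _≡_ f →
                 (∀ i → f i ∈ p) → k ≤ ∣ p ∣
injective⇒≤∣p∣ {k = zero}  p f inj f∈ = z≤n
injective⇒≤∣p∣ {k = suc k} p f inj f∈ =
  ≤-trans (s≤s (injective⇒≤∣p∣ (p - f zero) (f ∘ suc) (suc-injective ∘ inj) f∘suc∈))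
          (x∈p⇒∣p-x∣<∣p∣ (f∈ zero))
  where
  f∘suc∈ : ∀ i → f (suc i) ∈ p - f zero
  f∘suc∈ i = x∈p∧x≢y⇒x∈p-y (f∈ (suc i)) λ eq → contradiction (inj eq) λ ()

-- Components and monochromatic stars.

-- Reachability in an abstract finite graph is not decided here, hence the double
-- negation; it is harmless since components are only used to refute colourings.
¬¬component : (H : Graph n) → let open Graph H using (_~_) in
              ∀ {v} → v ∈ V H →
              ¬ ¬ (∃[ C ] IsComponent H C × v ∈ C × (∀ {w} → v ~ w → w ∈ C))
¬¬component H {v} v∈V ¬component =
  -- `Fin n` is finite, so the double negations of excluded middle at the single vertices combine
  -- into one.
  sequence (RawMonad.rawApplicative ¬¬-Monad) (λ _ → ¬¬-excluded-middle)
    λ reachable? → ¬component (component reachable?)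
  where
  open Graph H using (_~_; ~-sym; ~⇒∈V)

  component : U.Decidable (Star _~_ v) →
              ∃[ C ] IsComponent H C × v ∈ C × (∀ {w} → v ~ w → w ∈ C)
  component reachable? =
    C , (C⊆V , ((v , x∈p∩q⁺ (v∈V , v∈C)) , connected) , maximal) , v∈C ,
    λ v~w → ∈⟦⟧⁺ reachable? (v~w ◅ ε)
    where
    C = ⟦ reachable? ⟧
    open Graph (H [ C ]) using () renaming (_~_ to _~C_; ~-sym to ~C-sym)

    v∈C : v ∈ C
    v∈C = ∈⟦⟧⁺ reachable? ε

    endpoint∈V : ∀ {a x} → a ∈ V H → Star _~_ a x → x ∈ V H
    endpoint∈V a∈V ε          = a∈V
    endpoint∈V a∈V (a~b ◅ bx) = endpoint∈V (~⇒∈V (~-sym a~b)) bx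

    C⊆V : ∀ {x} → x ∈ C → x ∈ V H
    C⊆V = endpoint∈V v∈V ∘ ∈⟦⟧⁻ reachable?

    -- The walk already made from `v` is carried along: it certifies that the current vertex lies in
    -- `C`.
    restrict : ∀ {a x} → Star _~_ v a → Star _~_ a x → Star _~C_ a x
    restrict va ε          = ε
    restrict va (a~b ◅ bx) =
      (∈⟦⟧⁺ reachable? va , ∈⟦⟧⁺ reachable? vb , a~b) ◅ restrict vb bx
      where vb = va ◅◅ (a~b ◅ ε)

    fromRoot : ∀ {x} → x ∈ V (H [ C ]) → Star _~C_ v x
    fromRoot x∈ = restrict ε (∈⟦⟧⁻ reachable? (proj₂ (x∈p∩q⁻ (V H) C x∈)))

    connected : ∀ x y → x ∈ V (H [ C ]) → y ∈ V (H [ C ]) → Star _~C_ x y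
    connected x y x∈ y∈ =
      reverse (λ {a} {b} → ~C-sym {a} {b}) (fromRoot x∈) ◅◅ fromRoot y∈

    maximal : ∀ C′ → (∀ {x} → x ∈ C′ → x ∈ V H) → Connected (H [ C′ ]) →
              (∀ {x} → x ∈ C → x ∈ C′) → ∀ {x} → x ∈ C′ → x ∈ C
    maximal C′ C′⊆V (_ , conn) C⊆C′ {x} x∈C′ =
      -- A walk inside `C′` from `v` to `x` is also a walk in `H`.
      ∈⟦⟧⁺ reachable? (map⋆ (proj₂ ∘ proj₂)
        (conn v x (x∈p∩q⁺ (v∈V , C⊆C′ v∈C)) (x∈p∩q⁺ (C′⊆V x∈C′ , x∈C′))))

-- The rays lie in the component of `v` in its colour class, where `v` then has degree at least
-- `suc d`. The goal is a negation, so a doubly negated component suffices.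
noMonochromaticStar : (G : Graph n) (c : Colouring k G) → HasDefect G c d →
  let open Graph G using (_~_) in
  ∀ v (f : Fin (suc d) → Fin n) → Injective _≡_ _≡_ f →
  (∀ j → v ~ f j) → ¬ (∀ j → c (f j) ≡ c v)
noMonochromaticStar {d = d} G c defect v f inj v~f sameColour =
  ¬¬component H v∈H λ (C , isComponent , v∈C , nbrs∈C) →
    <⇒≱ (n<1+n d) (≤-trans
      (injective⇒≤∣p∣ _ f inj λ j → ∈⟦⟧⁺ (Graph._~?_ (H [ C ]) v)
        (v∈C , nbrs∈C (v~ᴴf j) , v~ᴴf j))
      (defect (c v) C isComponent v (x∈p∩q⁺ (v∈H , v∈C))))
  where
  open Graph G using (~⇒∈V)

  H = monochromatic G c (c v)
  open Graph H using () renaming (_~_ to _~ᴴ_)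

  class∋ : ∀ {x} → c x ≡ c v → x ∈ ⟦ (λ u → c u ≟ c v) ⟧
  class∋ = ∈⟦⟧⁺ (λ u → c u ≟ c v)

  v∈H : v ∈ V H
  v∈H = x∈p∩q⁺ (~⇒∈V (v~f zero) , class∋ refl)

  v~ᴴf : ∀ j → v ~ᴴ f j
  v~ᴴf j = class∋ refl , class∋ (sameColour j) , v~f j

-- Cycles, forests and feedback vertex sets.

cycleNeighbours : {H : Graph n} (cycle : Cycle H) → let open Graph H; open Cycle cycle in
  ∀ i → ∃[ a ] ∃[ b ] a ≢ b × vertex i ~ vertex a × vertex i ~ vertex b
cycleNeighbours {H = H} cycle = neighbours
  where
  open Graph H
  open Cycle cycle

  inject₁²≢suc² : ∀ {l} (j : Fin l) → inject₁ (inject₁ j) ≢ suc (suc j)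
  inject₁²≢suc² j eq = <⇒≱ (m<n⇒m<1+n (n<1+n (toℕ j))) (≤-reflexive
    (trans (sym (cong toℕ eq)) (trans (toℕ-inject₁ (inject₁ j)) (toℕ-inject₁ j))))

  neighbours : ∀ i → ∃[ a ] ∃[ b ] a ≢ b × vertex i ~ vertex a × vertex i ~ vertex b
  -- The second and last positions differ because a cycle has length at least three.
  neighbours zero = suc zero , fromℕ (2 + m) , (λ ()) , step zero , ~-sym close
  -- Only the last position uses `close`; otherwise both neighbours come from `step`.
  neighbours (suc i) with view i
  ... | ‵fromℕ          =
    inject₁ (fromℕ (1 + m)) , zero , (λ ()) , ~-sym (step (fromℕ (1 + m))) , close
  ... | ‵inj₁ {i = j} _ =
    inject₁ (inject₁ j) , suc (suc j) , inject₁²≢suc² j , ~-sym (step (inject₁ j)) , step (suc j)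

-- A vertex of a cycle has two neighbours on it, and at most one of them is its
-- parent; so the other is a child, and one can descend along the cycle forever.
parentOrientation⇒forest : (H : Graph n) → let open Graph H using (_~_) in
  (_⇢_ : Rel (Fin n) 0ℓ) → WellFounded _⇢_ →
  (∀ {x y} → x ~ y → x ⇢ y ⊎ y ⇢ x) →
  (∀ {x y z} → x ~ y → x ~ z → x ⇢ y → x ⇢ z → y ≡ z) →
  Forest H
parentOrientation⇒forest H _⇢_ wf orient unique cycle = offCycle zero (wf _)
  where
  open Cycle cycle

  offCycle : ∀ i → ¬ Acc _⇢_ (vertex i)
  offCycle i (acc rs) with cycleNeighbours cycle i
  ... | a , b , a≢b , i~a , i~b with orient i~a | orient i~b
  ... | inj₂ a⇢i | _        = offCycle a (rs a⇢i)
  ... | inj₁ _   | inj₂ b⇢i = offCycle b (rs b⇢i)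
  ... | inj₁ i⇢a | inj₁ i⇢b = a≢b (injective (unique i~a i~b i⇢a i⇢b))

-- Removing an empty `A` deletes nothing, so the given cycle survives.
cycle⇒nonemptyFeedbackVertexSet : (G : Graph n) → Cycle G →
                                  ∀ A → IsFeedbackVertexSet G A → 1 ≤ ∣ A ∣
cycle⇒nonemptyFeedbackVertexSet G cycle A (_ , forest) with nonempty? A
... | yes (x , x∈A) = ≤-trans (s≤s z≤n) (x∈p⇒∣p-x∣<∣p∣ x∈A)
... | no A-empty    = contradiction surviving forest
  where
  open Graph G using (_~_; ~-sym; ~⇒∈V)
  open Cycle cycle

  kept : ∀ {x y} → x ~ y → x ∈ V G ─ A × y ∈ V G ─ A × x ~ y
  kept x~y = survives (~⇒∈V x~y) , survives (~⇒∈V (~-sym x~y)) , x~y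
    where
    survives : ∀ {x} → x ∈ V G → x ∈ V G ─ A
    survives x∈V = x∈p∧x∉q⇒x∈p─q x∈V λ x∈A → A-empty (_ , x∈A)

  surviving : Cycle (G -V A)
  surviving = record
    { m = m ; vertex = vertex ; injective = injective
    ; step = kept ∘ step ; close = kept close }

-- The graph and its triangle-freeness.

module Construction (d : ℕ) where

  N M order : ℕ
  N     = suc d
  M     = suc N
  order = 1 + N * (M * M)

  -- Each gadget is an `M` by `M` grid: row `i` is a star whose entry `zero` is the centre and whose
  -- other `N` entries are its leaves. Row `zero` belongs to the hub, leaving `N` further centres.
  Vertex : Set
  Vertex = Fin 1 ⊎ (Fin N × Fin M × Fin M)

  pattern apex       = inj₁ zero
  pattern centre k i = inj₂ (k , i , zero)
  pattern leaf k i j = inj₂ (k , i , suc j)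

  vertices : Fin order ↔ Vertex
  vertices = ↔-trans +↔⊎ (↔-refl ⊎-↔ ↔-trans *↔× (↔-refl ×-↔ *↔×))

  open Inverse vertices using (to; from; strictlyInverseˡ; strictlyInverseʳ)

  to-injective : Injective _≡_ _≡_ to
  to-injective {x} {y} eq =
    trans (sym (strictlyInverseʳ x)) (trans (cong from eq) (strictlyInverseʳ y))

  from-injective : Injective _≡_ _≡_ from
  from-injective {u} {v} eq =
    trans (sym (strictlyInverseˡ u)) (trans (cong to eq) (strictlyInverseˡ v))

  infix 4 _⇢_ _⇢?_ _≈_

  -- Arcs point from child to parent. Without the apex they form one tree per gadget, rooted at the
  -- hub.
  data _⇢_ : Rel Vertex 0ℓ where
    leaf⇢apex   : ∀ {k i j} → leaf k i j ⇢ apex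
    leaf⇢centre : ∀ {k i j} → leaf k i j ⇢ centre k i
    centre⇢hub  : ∀ {k i} → centre k (suc i) ⇢ centre k zero

  _⇢?_ : Decidable _⇢_
  apex             ⇢? _                 = no λ ()
  leaf _ _ _       ⇢? apex              = yes leaf⇢apex
  leaf _ _ _       ⇢? leaf _ _ _        = no λ ()
  leaf k i _       ⇢? centre k′ i′ with k ≟ k′ | i ≟ i′
  ... | yes refl | yes refl = yes leaf⇢centre
  ... | no k≢k′  | _        = no λ { leaf⇢centre → k≢k′ refl }
  ... | _        | no i≢i′  = no λ { leaf⇢centre → i≢i′ refl }
  centre _ _       ⇢? apex              = no λ ()
  centre _ _       ⇢? leaf _ _ _        = no λ ()
  centre _ _       ⇢? centre _ (suc _)  = no λ ()
  centre _ zero    ⇢? centre _ zero     = no λ ()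
  centre k (suc _) ⇢? centre k′ zero    =
    map′ (λ { refl → centre⇢hub }) (λ { centre⇢hub → refl }) (k ≟ k′)

  _≈_ : Rel Vertex 0ℓ
  u ≈ v = u ⇢ v ⊎ v ⇢ u

  ≈-irrefl : ∀ {u} → ¬ u ≈ u
  ≈-irrefl (inj₁ ())
  ≈-irrefl (inj₂ ())

  G : Graph order
  G = record
    { V        = full
    ; _~_      = _≈_ on to
    ; _~?_     = λ x y → (to x ⇢? to y) ⊎-dec (to y ⇢? to x)
    ; ~-sym    = swap
    ; ~-irrefl = λ { refl → ≈-irrefl }
    ; ~⇒∈V     = λ _ → ∈⊤
    }

  open Graph G using (_~_)

  from-~ : ∀ u v → u ≈ v → from u ~ from v
  from-~ u v =
    subst₂ _≈_ (sym (strictlyInverseˡ u)) (sym (strictlyInverseˡ v))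

  -- Apex and hubs have no outgoing arcs, so a path of two arcs runs from a leaf through its non-hub
  -- centre to the hub.
  path⇒nonadjacent : ∀ {u v w} → u ⇢ v → v ⇢ w → ¬ u ≈ w
  path⇒nonadjacent leaf⇢centre centre⇢hub (inj₁ ())
  path⇒nonadjacent leaf⇢centre centre⇢hub (inj₂ ())

  -- Whatever the orientation of a triangle, two of its arcs form a directed path.
  triangleFree : TriangleFree G
  triangleFree _ _ _ (inj₁ uv , inj₁ vw , wu)      = path⇒nonadjacent uv vw (swap wu)
  triangleFree _ _ _ (inj₂ vu , inj₂ wv , wu)      = path⇒nonadjacent wv vu wu
  triangleFree _ _ _ (inj₁ uv , inj₂ wv , inj₁ wu) = path⇒nonadjacent wu uv (inj₁ wv)
  triangleFree _ _ _ (inj₁ uv , inj₂ wv , inj₂ uw) = path⇒nonadjacent uw wv (inj₁ uv)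
  triangleFree _ _ _ (inj₂ vu , inj₁ vw , inj₁ wu) = path⇒nonadjacent vw wu (inj₁ vu)
  triangleFree _ _ _ (inj₂ vu , inj₁ vw , inj₂ uw) = path⇒nonadjacent vu uw (inj₁ vw)

  -- Feedback vertex number.

  ⇢-wellFounded : WellFounded _⇢_
  ⇢-wellFounded = wf
    where
    wf-leaf : ∀ {k i j} → Acc _⇢_ (leaf k i j)
    wf-leaf = acc λ ()

    wf-centre : ∀ {k i} → Acc _⇢_ (centre k (suc i))
    wf-centre = acc λ { leaf⇢centre → wf-leaf }

    wf : WellFounded _⇢_
    wf apex               = acc λ { leaf⇢apex → wf-leaf }
    wf (leaf _ _ _)       = wf-leaf
    wf (centre _ (suc _)) = wf-centre
    wf (centre _ zero)    = acc λ { leaf⇢centre → wf-leaf ; centre⇢hub → wf-centre }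

  -- Only leaves have two outgoing arcs, and one of these ends at the apex. This is where deleting
  -- the apex matters; well-foundedness holds in all of `G`.
  ⇢-unique : ∀ {u v w} → v ≢ apex → w ≢ apex → u ⇢ v → u ⇢ w → v ≡ w
  ⇢-unique v≢ w≢ leaf⇢apex   _           = contradiction refl v≢
  ⇢-unique v≢ w≢ leaf⇢centre leaf⇢apex   = contradiction refl w≢
  ⇢-unique v≢ w≢ leaf⇢centre leaf⇢centre = refl
  ⇢-unique v≢ w≢ centre⇢hub  centre⇢hub  = refl

  apexIsFeedbackVertexSet : IsFeedbackVertexSet G ⁅ from apex ⁆
  apexIsFeedbackVertexSet = (λ _ → ∈⊤) ,
    parentOrientation⇒forest (G -V ⁅ from apex ⁆) (_⇢_ on to)
      (On.wellFounded to ⇢-wellFounded)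
      (λ (_ , _ , u~v) → u~v)
      λ (_ , v∈ , _) (_ , w∈ , _) u⇢v u⇢w →
        to-injective (⇢-unique (≢apex v∈) (≢apex w∈) u⇢v u⇢w)
    where
    ≢apex : ∀ {x} → x ∈ full ─ ⁅ from apex ⁆ → to x ≢ apex
    ≢apex {x} x∈ eq = x∈p─q⇒x∉q full _ x∈
      (subst (_∈ ⁅ from apex ⁆) (trans (cong from (sym eq)) (strictlyInverseʳ x)) (x∈⁅x⁆ _))

  -- It exists for every `d`. For `d = 0` each centre has a single leaf, so there is no four-cycle
  -- through the apex and two leaves of one centre.
  pentagon : Cycle G
  pentagon = record
    { m         = 2
    ; vertex    = from ∘ corner
    ; injective = corner-injective ∘ from-injective
    ; step      = λ i → from-~ (corner (inject₁ i)) (corner (suc i)) (corner-step i)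
    ; close     = from-~ (corner (fromℕ 4)) apex (inj₁ leaf⇢apex)
    }
    where
    corner : Fin 5 → Vertex
    corner = lookup
      ( apex ∷ leaf zero zero zero ∷ centre zero zero
      ∷ centre zero (suc zero) ∷ leaf zero (suc zero) zero ∷ [] )

    -- A left inverse of `corner`, giving injectivity; its values off the five corners are
    -- arbitrary.
    position : Vertex → Fin 5
    position apex               = zero
    position (leaf _ zero _)    = suc zero
    position (centre _ zero)    = suc (suc zero)
    position (centre _ (suc _)) = suc (suc (suc zero))
    position (leaf _ (suc _) _) = suc (suc (suc (suc zero)))

    position∘corner : ∀ i → position (corner i) ≡ i
    position∘corner zero                         = refl
    position∘corner (suc zero)                   = refl
    position∘corner (suc (suc zero))             = refl
    position∘corner (suc (suc (suc zero)))       = refl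
    position∘corner (suc (suc (suc (suc zero)))) = refl

    corner-injective : Injective _≡_ _≡_ corner
    corner-injective {x} {y} eq =
      trans (sym (position∘corner x)) (trans (cong position eq) (position∘corner y))

    corner-step : ∀ (i : Fin 4) → corner (inject₁ i) ≈ corner (suc i)
    corner-step zero                   = inj₂ leaf⇢apex
    corner-step (suc zero)             = inj₁ leaf⇢centre
    corner-step (suc (suc zero))       = inj₂ centre⇢hub
    corner-step (suc (suc (suc zero))) = inj₂ leaf⇢centre

  feedbackVertexNumber : HasFeedbackVertexNumber G 1
  feedbackVertexNumber =
    (⁅ from apex ⁆ , apexIsFeedbackVertexSet , ∣⁅x⁆∣≡1 (from apex)) ,
    cycle⇒nonemptyFeedbackVertexSet G pentagon

  -- Failure of every 2-colouring.

  two-colours : ∀ {a b c : Fin 2} → a ≢ b → c ≢ b → a ≡ c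
  two-colours {zero}     {b}        {zero}     _   _   = refl
  two-colours {suc zero} {b}        {suc zero} _   _   = refl
  two-colours {zero}     {zero}     {suc zero} a≢b _   = contradiction refl a≢b
  two-colours {zero}     {suc zero} {suc zero} _   c≢b = contradiction refl c≢b
  two-colours {suc zero} {zero}     {zero}     _   c≢b = contradiction refl c≢b
  two-colours {suc zero} {suc zero} {zero}     a≢b _   = contradiction refl a≢b

  notColourable : ¬ ColourableWithDefect 2 d G
  -- No good gadget is searched for: every gadget is shown to contain a leaf coloured like the apex,
  -- and these leaves form a forbidden star at the apex.
  notColourable (c , defect) = noMonochromaticLeafEverywhere λ k →
    decidable-stable (likeApex? k) (noGoodGadget k)
    where
    colour : Vertex → Fin 2
    colour = c ∘ from

    noStar : ∀ v (f : Fin N → Vertex) → Injective _≡_ _≡_ f →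
             (∀ j → v ≈ f j) → ¬ (∀ j → colour (f j) ≡ colour v)
    noStar v f inj v≈f = noMonochromaticStar G c defect (from v) (from ∘ f)
      (inj ∘ from-injective) (λ j → from-~ v (f j) (v≈f j))

    LikeApex : Fin N → Set
    LikeApex k = ∃[ i ] ∃[ j ] colour (leaf k i j) ≡ colour apex

    likeApex? : U.Decidable LikeApex
    likeApex? k = any? λ i → any? λ j → colour (leaf k i j) ≟ colour apex

    noMonochromaticLeafEverywhere : ¬ (∀ k → LikeApex k)
    noMonochromaticLeafEverywhere like = noStar apex
      (λ k → leaf k (proj₁ (like k)) (proj₁ (proj₂ (like k))))
      -- The chosen leaves are distinct because they lie in distinct gadgets.
      (λ { refl → refl }) (λ _ → inj₂ leaf⇢apex) (λ k → proj₂ (proj₂ (like k)))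

    noGoodGadget : ∀ k → ¬ ¬ LikeApex k
    noGoodGadget k unlike = noStar (centre k zero) (λ i → centre k (suc i))
      (λ { refl → refl }) (λ _ → inj₂ centre⇢hub)
      (λ i → trans (centreLikeApex (suc i)) (sym (centreLikeApex zero)))
      where
      centreLikeApex : ∀ i → colour (centre k i) ≡ colour apex
      -- If the centre differs from the apex, so do all its leaves by `unlike`; with two colours
      -- they agree with the centre.
      centreLikeApex i = decidable-stable (_ ≟ _) λ differs →
        noStar (centre k i) (λ j → leaf k i j) (λ { refl → refl }) (λ _ → inj₂ leaf⇢centre)
          λ j → two-colours (λ eq → unlike (i , j , eq)) differs

proposition15 : ∀ (d : ℕ) → ∃[ n ] Σ[ G ∈ Graph n ]
    (TriangleFree G × HasFeedbackVertexNumber G 1 × ¬ ColourableWithDefect 2 d G)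
proposition15 d = order , G , triangleFree , feedbackVertexNumber , notColourable
  where open Construction d
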